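{- The following decision problem is decidable: given a simple signature, a decidable effect theory $\mathcal{T}$ over it, and a uniformly simple family of closed handlers over it (i.e. a template $x:\alpha\mid z:\beta\vdash T_{\mathsf{op}}$ for each operation symbol $\mathsf{op}:\alpha\to\beta$), decide whether the family is correct, i.e. whether for every computation type $\underline{C}$, the carrier $|[\![\underline{C}]\!]|$ equipped with the operations $\mathsf{op}_H(a,\kappa)=[\![T_{\mathsf{op}}]\!]_{[\![\underline{C}]\!]}(a,\kappa)$ forms a model of $\mathcal{T}$.
   Context: A simple signature is a finite set of operation symbols $\mathsf{op}:\alpha\to\beta$ with types $\alpha,\beta::=1\mid\alpha\times\beta\mid\sum_{\ell\in L}\alpha_\ell$ ($L$ finite), no base types and no function symbols; every such type denotes a finite set. Signature values are built from variables, $\langle\rangle$, pairs and injections. Templates over a value context $\Gamma$ and template context $Z=z_1:\alpha_1,\dots,z_n:\alpha_n$ are $T::=z(V)\mid\mathsf{match}\ V\ \mathsf{with}\ \langle x,y\rangle\mapsto T\mid\mathsf{match}\ V\ \mathsf{with}\ \{\ell(x_\ell)\mapsto T_\ell\}_{\ell\in L}\mid\mathsf{op}_V(x:\beta.T)$ with evident typing. An effect theory is a finite set of equations $\Gamma\mid Z\vdash T_1=T_2$. For a set $|\mathcal{M}|$ with maps $\mathsf{op}_{\mathcal{M}}:[\![\alpha]\!]\times|\mathcal{M}|^{[\![\beta]\!]}\to|\mathcal{M}|$, templates denote maps $[\![T]\!]_{\mathcal{M}}$: $z_j(V)\mapsto b_j([\![V]\!](a))$, matches select the branch, $\mathsf{op}_V(x.T)\mapsto\mathsf{op}_{\mathcal{M}}([\![V]\!](a),x\mapsto[\![T]\!]_{\mathcal{M}}(\langle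 a,x\rangle,b))$; a model satisfies all equations of $\mathcal{T}$. A simple-signature effect theory corresponds to an ordinary finitary equational theory $\mathcal{T}_f$ with finitely many function symbols $\mathsf{op}_a$ of arity $|[\![\beta]\!]|$ (one for each $\mathsf{op}:\alpha\to\beta$ and $a\in[\![\alpha]\!]$) and finitely many axioms $T_1^c=T_2^c$ (one for each equation $\Gamma\mid Z\vdash T_1=T_2$ of $\mathcal{T}$ and $c\in[\![\Gamma]\!]$), where $T^c$ is the term obtained by evaluating the value parts at $c$; $\mathcal{T}$ is decidable if provability of equations in $\mathcal{T}_f$ is decidable. Value types $A::=1\mid A\times B\mid\sum_\ell A_\ell\mid U\underline{C}$ and computation types $\underline{C}::=FA\mid\prod_\ell\underline{C}_\ell\mid A\to\underline{C}$ are interpreted: value types as sets ($[\![U\underline{C}]\!]$ the carrier of $[\![\underline{C}]\!]$), $[\![FA]\!]$ the free model of $\mathcal{T}$ over $[\![A]\!]$, products as product models with componentwise operations, $[\![A\to\underline{C}]\!]$ as the exponent model with pointwise operations. In $[\![T_{\mathsf{op}}]\!]_{[\![\underline{C}]\!]}$ operations are interpreted by the original operations of $[\![\underline{C}]\!]$. -}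

module Defs where

open import Level using (0ℓ)
open import Data.Nat.Base using (ℕ)
open import Data.Fin.Base using (Fin)
open import Data.Unit.Base using (⊤; tt)
open import Data.Product.Base using (Σ; ∃; _×_; _,_)
open import Data.Product.Relation.Binary.Pointwise.NonDependent using (×-setoid)
open import Data.List.Base using (List; []; _∷_)
open import Data.List.Relation.Unary.All as All using (All; []; _∷_)
open import Data.List.Relation.Unary.All.Properties using (lookup-map)
open import Data.List.Relation.Unary.Any using (here; there)
open import Data.List.Membership.Propositional using (_∈_)
open import Function.Base using (_∘_)
open import Function.Bundles using (Func; _⟨$⟩_)
open import Function.Relation.Binary.Setoid.Equality using (_⇨_)
open import Relation.Binary.Bundles using (Setoid)
open import Relation.Binary.PropositionalEquality as ≡ using (_≡_; refl)
open import Relation.Nullary.Decidable.Core using (Dec)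

-- Every finite label set L is presented as Fin n.

data Ty : Set where
  𝟙   : Ty
  _⊗_ : Ty → Ty → Ty
  ⨁   : (n : ℕ) → (Fin n → Ty) → Ty

⟦_⟧ : Ty → Set
⟦ 𝟙 ⟧      = ⊤
⟦ α ⊗ β ⟧  = ⟦ α ⟧ × ⟦ β ⟧
⟦ ⨁ n αs ⟧ = Σ (Fin n) λ ℓ → ⟦ αs ℓ ⟧

record Signature : Set where
  field
    #ops : ℕ
    dom  : Fin #ops → Ty
    cod  : Fin #ops → Ty

  Op : Set
  Op = Fin #ops

open Signature public using (Op; dom; cod)

Ctx : Set
Ctx = List Ty

⟦_⟧ctx : Ctx → Set
⟦ Γ ⟧ctx = All ⟦_⟧ Γ

data Val (Γ : Ctx) : Ty → Set where
  var  : ∀ {α} → α ∈ Γ → Val Γ α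
  ⟨⟩   : Val Γ 𝟙
  pair : ∀ {α β} → Val Γ α → Val Γ β → Val Γ (α ⊗ β)
  inj  : ∀ {n αs} (ℓ : Fin n) → Val Γ (αs ℓ) → Val Γ (⨁ n αs)

⟦_⟧val : ∀ {Γ α} → Val Γ α → ⟦ Γ ⟧ctx → ⟦ α ⟧
⟦ var x ⟧val    c = All.lookup c x
⟦ ⟨⟩ ⟧val       c = tt
⟦ pair V W ⟧val c = ⟦ V ⟧val c , ⟦ W ⟧val c
⟦ inj ℓ V ⟧val  c = ℓ , ⟦ V ⟧val c

data Template (S : Signature) (Γ Z : Ctx) : Set where
  tvar   : ∀ {α} → α ∈ Z → Val Γ α → Template S Γ Z
  match× : ∀ {α β} → Val Γ (α ⊗ β) → Template S (β ∷ α ∷ Γ) Z → Template S Γ Z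
  match⨁ : ∀ {n αs} → Val Γ (⨁ n αs) →
           ((ℓ : Fin n) → Template S (αs ℓ ∷ Γ) Z) → Template S Γ Z
  op     : (o : Op S) → Val Γ (dom S o) → Template S (cod S o ∷ Γ) Z → Template S Γ Z

record Equation (S : Signature) : Set where
  field
    Γ Z     : Ctx
    lhs rhs : Template S Γ Z

Theory : Signature → Set
Theory S = List (Equation S)

-- Quotients (needed for free models) are rendered by setoids, so the sets
-- |M| are setoids and operations respect their equality. Signature types
-- denote finite sets with propositional equality.

record Structure (S : Signature) : Set₁ where
  field
    setoid : Setoid 0ℓ 0ℓ
  open Setoid setoid public using (Carrier; _≈_)
  field
    ⟪_⟫    : (o : Op S) → ⟦ dom S o ⟧ → (⟦ cod S o ⟧ → Carrier) → Carrier
    ⟪⟫-cong : ∀ o a {κ κ′ : ⟦ cod S o ⟧ → Carrier} →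
              (∀ x → κ x ≈ κ′ x) → ⟪ o ⟫ a κ ≈ ⟪ o ⟫ a κ′

module _ {S : Signature} where

  TEnv : Structure S → Ctx → Set
  TEnv M Z = All (λ α → ⟦ α ⟧ → Structure.Carrier M) Z

  ⟦_⟧⟨_⟩ : ∀ {Γ Z} → Template S Γ Z → (M : Structure S) →
           ⟦ Γ ⟧ctx → TEnv M Z → Structure.Carrier M
  ⟦ tvar z V ⟧⟨ M ⟩    c b = All.lookup b z (⟦ V ⟧val c)
  ⟦ match× V T ⟧⟨ M ⟩  c b with ⟦ V ⟧val c
  ... | x , y = ⟦ T ⟧⟨ M ⟩ (y ∷ x ∷ c) b
  ⟦ match⨁ V Ts ⟧⟨ M ⟩ c b with ⟦ V ⟧val c
  ... | ℓ , x = ⟦ Ts ℓ ⟧⟨ M ⟩ (x ∷ c) b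
  ⟦ op o V T ⟧⟨ M ⟩    c b =
    Structure.⟪_⟫ M o (⟦ V ⟧val c) (λ x → ⟦ T ⟧⟨ M ⟩ (x ∷ c) b)

  module _ (M : Structure S) where
    open Structure M

    tmpl-cong : ∀ {Γ Z} (T : Template S Γ Z) c {b b′ : TEnv M Z} →
                (∀ {α} (z : α ∈ Z) a → All.lookup b z a ≈ All.lookup b′ z a) →
                ⟦ T ⟧⟨ M ⟩ c b ≈ ⟦ T ⟧⟨ M ⟩ c b′
    tmpl-cong (tvar z V)    c b≈ = b≈ z _
    tmpl-cong (match× V T)  c b≈ = tmpl-cong T _ b≈
    tmpl-cong (match⨁ V Ts) c b≈ = tmpl-cong (Ts _) _ b≈
    tmpl-cong (op o V T)    c b≈ = ⟪⟫-cong o _ λ x → tmpl-cong T _ b≈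

    Satisfies : Equation S → Set
    Satisfies e = ∀ c b → ⟦ lhs ⟧⟨ M ⟩ c b ≈ ⟦ rhs ⟧⟨ M ⟩ c b
      where open Equation e

    IsModel : Theory S → Set
    IsModel 𝒯 = ∀ {e} → e ∈ 𝒯 → Satisfies e

record Model {S : Signature} (𝒯 : Theory S) : Set₁ where
  field
    structure : Structure S
    isModel   : IsModel structure 𝒯
  open Structure structure public

record IsHom {S : Signature} (M N : Structure S)
             (h : Structure.Carrier M → Structure.Carrier N) : Set where
  private
    module M = Structure M
    module N = Structure N
  field
    cong : ∀ {x y} → x M.≈ y → h x N.≈ h y
    pres : ∀ o a κ → h (M.⟪ o ⟫ a κ) N.≈ N.⟪ o ⟫ a (h ∘ κ)

module _ {S : Signature} {M N : Structure S} {h : Structure.Carrier M → Structure.Carrier N}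
         (hom : IsHom M N h) where
  private
    module N = Structure N
    module NS = Setoid N.setoid
  open IsHom hom

  hom-tmpl : ∀ {Γ Z} (T : Template S Γ Z) c (b : TEnv M Z) →
             h (⟦ T ⟧⟨ M ⟩ c b) N.≈ ⟦ T ⟧⟨ N ⟩ c (All.map (h ∘_) b)
  hom-tmpl (tvar z V)    c b =
    NS.reflexive (≡.cong {A = ⟦ _ ⟧ → N.Carrier} (λ f → f (⟦ V ⟧val c))
                    (≡.sym (lookup-map {f = h ∘_} b z)))
  hom-tmpl (match× V T)  c b = hom-tmpl T _ b
  hom-tmpl (match⨁ V Ts) c b = hom-tmpl (Ts _) _ b
  hom-tmpl (op o V T)    c b =
    NS.trans (pres o _ _) (N.⟪⟫-cong o _ λ x → hom-tmpl T _ b)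

  hom-satisfies : ∀ {e} → Satisfies N e → ∀ c b →
                  h (⟦ Equation.lhs e ⟧⟨ M ⟩ c b) N.≈ h (⟦ Equation.rhs e ⟧⟨ M ⟩ c b)
  hom-satisfies {e} sat c b =
    NS.trans (hom-tmpl (Equation.lhs e) c b)
      (NS.trans (sat c _) (NS.sym (hom-tmpl (Equation.rhs e) c b)))

-- The function symbols are the pairs (o , a); the |⟦β⟧| arguments of a
-- symbol are indexed by the finite set ⟦β⟧ itself.

data Term (S : Signature) (X : Set) : Set where
  var : X → Term S X
  app : (o : Op S) → ⟦ dom S o ⟧ → (⟦ cod S o ⟧ → Term S X) → Term S X

-- A template context z₁:α₁,…,zₙ:αₙ contributes one variable of 𝒯_f for
-- each zⱼ and each element of ⟦αⱼ⟧.

TVar : Ctx → Set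
TVar Z = ∃ λ α → α ∈ Z × ⟦ α ⟧

module _ {S : Signature} where

  sub : ∀ {X Y} → (X → Term S Y) → Term S X → Term S Y
  sub σ (var x)     = σ x
  sub σ (app o a k) = app o a λ x → sub σ (k x)

  -- T ^ c is the term obtained by evaluating the value parts of T at c.
  _^_ : ∀ {Γ Z} → Template S Γ Z → ⟦ Γ ⟧ctx → Term S (TVar Z)
  tvar z V    ^ c = var (_ , z , ⟦ V ⟧val c)
  match× V T  ^ c with ⟦ V ⟧val c
  ... | x , y = T ^ (y ∷ x ∷ c)
  match⨁ V Ts ^ c with ⟦ V ⟧val c
  ... | ℓ , x = Ts ℓ ^ (x ∷ c)
  op o V T    ^ c = app o (⟦ V ⟧val c) λ x → T ^ (x ∷ c)

  -- Equational logic over 𝒯_f, with the substitution rule built into ax.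
  -- Variables are drawn from a setoid: ≡.setoid ℕ gives ordinary
  -- provability, and ⟦A⟧ gives equality in the free model over ⟦A⟧.

  data Provable (𝒯 : Theory S) (X : Setoid 0ℓ 0ℓ) :
                (t u : Term S (Setoid.Carrier X)) → Set where
    ax     : ∀ {e} → e ∈ 𝒯 → (c : ⟦ Equation.Γ e ⟧ctx)
             (σ : TVar (Equation.Z e) → Term S (Setoid.Carrier X)) →
             Provable 𝒯 X (sub σ (Equation.lhs e ^ c)) (sub σ (Equation.rhs e ^ c))
    ≈var   : ∀ {x y} → Setoid._≈_ X x y → Provable 𝒯 X (var x) (var y)
    ≈app   : ∀ o a {k k′} → (∀ x → Provable 𝒯 X (k x) (k′ x)) →
             Provable 𝒯 X (app o a k) (app o a k′)
    ≈refl  : ∀ {t} → Provable 𝒯 X t t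
    ≈sym   : ∀ {t u} → Provable 𝒯 X t u → Provable 𝒯 X u t
    ≈trans : ∀ {t u v} → Provable 𝒯 X t u → Provable 𝒯 X u v → Provable 𝒯 X t v

  DecidableTheory : Theory S → Set
  DecidableTheory 𝒯 = (t u : Term S ℕ) → Dec (Provable 𝒯 (≡.setoid ℕ) t u)

module _ {S : Signature} (𝒯 : Theory S) (X : Setoid 0ℓ 0ℓ) where
  private
    module X = Setoid X

  freeStructure : Structure S
  freeStructure = record
    { setoid = record
      { Carrier       = Term S X.Carrier
      ; _≈_           = Provable 𝒯 X
      ; isEquivalence = record { refl = ≈refl ; sym = ≈sym ; trans = ≈trans }
      }
    ; ⟪_⟫     = app
    ; ⟪⟫-cong = ≈app
    }

  free-tmpl : ∀ {Γ Z} (T : Template S Γ Z) c (b : TEnv freeStructure Z) →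
              Provable 𝒯 X (⟦ T ⟧⟨ freeStructure ⟩ c b)
                           (sub (λ (_ , z , a) → All.lookup b z a) (T ^ c))
  free-tmpl (tvar z V)    c b = ≈refl
  free-tmpl (match× V T)  c b = free-tmpl T _ b
  free-tmpl (match⨁ V Ts) c b = free-tmpl (Ts _) _ b
  free-tmpl (op o V T)    c b = ≈app o _ λ x → free-tmpl T _ b

  freeModel : Model 𝒯
  freeModel = record
    { structure = freeStructure
    ; isModel   = λ {e} e∈𝒯 c b →
        ≈trans (free-tmpl (Equation.lhs e) c b)
          (≈trans (ax e∈𝒯 c _) (≈sym (free-tmpl (Equation.rhs e) c b)))
    }

  -- Universal property: every f : X → |M| extends along var to a unique
  -- homomorphism.

  module _ (M : Model 𝒯) (f : Func X (Model.setoid M)) where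
    private
      module M  = Model M
      module MS = Setoid M.setoid

    extend : Term S X.Carrier → M.Carrier
    extend (var x)     = f ⟨$⟩ x
    extend (app o a k) = M.⟪ o ⟫ a λ x → extend (k x)

    private
      extend-^ : ∀ {Γ Z} (T : Template S Γ Z) c (σ : TVar Z → Term S X.Carrier)
                 (b : TEnv M.structure Z) →
                 (∀ {α} (z : α ∈ Z) a → extend (σ (α , z , a)) M.≈ All.lookup b z a) →
                 extend (sub σ (T ^ c)) M.≈ ⟦ T ⟧⟨ M.structure ⟩ c b
      extend-^ (tvar z V)    c σ b eq = eq z _
      extend-^ (match× V T)  c σ b eq = extend-^ T _ σ b eq
      extend-^ (match⨁ V Ts) c σ b eq = extend-^ (Ts _) _ σ b eq
      extend-^ (op o V T)    c σ b eq = M.⟪⟫-cong o _ λ x → extend-^ T _ σ b eq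

      lookup-tab : ∀ {Z} (g : ∀ {α} → α ∈ Z → ⟦ α ⟧ → M.Carrier) {α} (z : α ∈ Z) a →
                   g z a ≡ All.lookup (All.tabulate g) z a
      lookup-tab g (here refl) a = refl
      lookup-tab g (there z)   a = lookup-tab (g ∘ there) z a

      extend-cong : ∀ {t u} → Provable 𝒯 X t u → extend t M.≈ extend u
      extend-cong (ax {e} e∈𝒯 c σ) =
        MS.trans (extend-^ (Equation.lhs e) c σ b eq)
          (MS.trans (M.isModel e∈𝒯 c b) (MS.sym (extend-^ (Equation.rhs e) c σ b eq)))
        where
        b : TEnv M.structure (Equation.Z e)
        b = All.tabulate λ z a → extend (σ (_ , z , a))
        eq : ∀ {α} (z : α ∈ Equation.Z e) a → extend (σ (α , z , a)) M.≈ All.lookup b z a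
        eq z a = MS.reflexive (lookup-tab (λ z a → extend (σ (_ , z , a))) z a)
      extend-cong (≈var x≈y)   = Func.cong f x≈y
      extend-cong (≈app o a p) = M.⟪⟫-cong o a λ x → extend-cong (p x)
      extend-cong ≈refl        = MS.refl
      extend-cong (≈sym p)     = MS.sym (extend-cong p)
      extend-cong (≈trans p q) = MS.trans (extend-cong p) (extend-cong q)

    extend-hom : IsHom freeStructure M.structure extend
    extend-hom = record { cong = extend-cong ; pres = λ o a κ → MS.refl }

    extend-unique : ∀ {h} → IsHom freeStructure M.structure h →
                    (∀ x → h (var x) M.≈ f ⟨$⟩ x) → ∀ t → h t M.≈ extend t
    extend-unique hom eq (var x)     = eq x
    extend-unique hom eq (app o a k) =
      MS.trans (IsHom.pres hom o a k) (M.⟪⟫-cong o a λ x → extend-unique hom eq (k x))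

module _ {S : Signature} {𝒯 : Theory S} where

  productModel : ∀ {n} → (Fin n → Model 𝒯) → Model 𝒯
  productModel {n} Ms = record
    { structure = P
    ; isModel   = λ {e} e∈𝒯 c b ℓ → hom-satisfies (proj ℓ) {e} (M.isModel ℓ e∈𝒯) c b
    }
    where
    module M (ℓ : Fin n) = Model (Ms ℓ)
    module MS (ℓ : Fin n) = Setoid (M.setoid ℓ)
    P : Structure S
    P = record
      { setoid = record
        { Carrier       = ∀ ℓ → M.Carrier ℓ
        ; _≈_           = λ f g → ∀ ℓ → MS._≈_ ℓ (f ℓ) (g ℓ)
        ; isEquivalence = record
          { refl  = λ ℓ → MS.refl ℓ
          ; sym   = λ p ℓ → MS.sym ℓ (p ℓ)
          ; trans = λ p q ℓ → MS.trans ℓ (p ℓ) (q ℓ)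
          }
        }
      ; ⟪_⟫     = λ o a κ ℓ → M.⟪_⟫ ℓ o a λ x → κ x ℓ
      ; ⟪⟫-cong = λ o a κ≈ ℓ → M.⟪⟫-cong ℓ o a λ x → κ≈ x ℓ
      }
    proj : ∀ ℓ → IsHom P (M.structure ℓ) λ f → f ℓ
    proj ℓ = record { cong = λ p → p ℓ ; pres = λ o a κ → MS.refl ℓ }

  exponentModel : Setoid 0ℓ 0ℓ → Model 𝒯 → Model 𝒯
  exponentModel A M = record
    { structure = E
    ; isModel   = λ {e} e∈𝒯 c b x → hom-satisfies (eval x) {e} (M.isModel e∈𝒯) c b
    }
    where
    module M  = Model M
    module MS = Setoid M.setoid
    E : Structure S
    E = record
      { setoid  = A ⇨ M.setoid
      ; ⟪_⟫     = λ o a κ → record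
        { to   = λ x → M.⟪ o ⟫ a λ y → κ y ⟨$⟩ x
        ; cong = λ x≈x′ → M.⟪⟫-cong o a λ y → Func.cong (κ y) x≈x′
        }
      ; ⟪⟫-cong = λ o a κ≈ x → M.⟪⟫-cong o a λ y → κ≈ y x
      }
    eval : ∀ x → IsHom E M.structure (_⟨$⟩ x)
    eval x = record { cong = λ p → p x ; pres = λ o a κ → MS.refl }

mutual
  data VTy : Set where
    𝟙   : VTy
    _⊗_ : VTy → VTy → VTy
    ⨁   : (n : ℕ) → (Fin n → VTy) → VTy
    U   : CTy → VTy

  data CTy : Set where
    F   : VTy → CTy
    ∏   : (n : ℕ) → (Fin n → CTy) → CTy
    _⇒_ : VTy → CTy → CTy

module _ {n : ℕ} (As : Fin n → Setoid 0ℓ 0ℓ) where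
  private
    module A (ℓ : Fin n) = Setoid (As ℓ)

  data SumEq : (x y : Σ (Fin n) A.Carrier) → Set where
    inj : ∀ ℓ {x y} → A._≈_ ℓ x y → SumEq (ℓ , x) (ℓ , y)

  sumSetoid : Setoid 0ℓ 0ℓ
  sumSetoid = record
    { Carrier       = Σ (Fin n) A.Carrier
    ; _≈_           = SumEq
    ; isEquivalence = record
      { refl  = inj _ (A.refl _)
      ; sym   = λ { (inj ℓ p) → inj ℓ (A.sym ℓ p) }
      ; trans = λ { (inj ℓ p) (inj .ℓ q) → inj ℓ (A.trans ℓ p q) }
      }
    }

module _ {S : Signature} (𝒯 : Theory S) where

  ⟦_⟧v : VTy → Setoid 0ℓ 0ℓ
  ⟦_⟧c : CTy → Model 𝒯

  ⟦ 𝟙 ⟧v      = ≡.setoid ⊤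
  ⟦ A ⊗ B ⟧v  = ×-setoid ⟦ A ⟧v ⟦ B ⟧v
  ⟦ ⨁ n As ⟧v = sumSetoid λ ℓ → ⟦ As ℓ ⟧v
  ⟦ U C ⟧v    = Model.setoid ⟦ C ⟧c

  ⟦ F A ⟧c    = freeModel 𝒯 ⟦ A ⟧v
  ⟦ ∏ n Cs ⟧c = productModel λ ℓ → ⟦ Cs ℓ ⟧c
  ⟦ A ⇒ C ⟧c  = exponentModel ⟦ A ⟧v ⟦ C ⟧c

HandlerFamily : Signature → Set
HandlerFamily S = (o : Op S) → Template S (dom S o ∷ []) (cod S o ∷ [])

module _ {S : Signature} where

  handled : HandlerFamily S → Structure S → Structure S
  handled H M = record
    { setoid  = Structure.setoid M
    ; ⟪_⟫     = λ o a κ → ⟦ H o ⟧⟨ M ⟩ (a ∷ []) (κ ∷ [])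
    ; ⟪⟫-cong = λ o a κ≈ → tmpl-cong M (H o) _ λ { (here refl) → κ≈ }
    }

  Correct : Theory S → HandlerFamily S → Set
  Correct 𝒯 H = (C : CTy) → IsModel (handled H (Model.structure (⟦_⟧c 𝒯 C))) 𝒯

{-# OPTIONS --safe #-}
-- A homomorphism of models is also a homomorphism of the handled structures,
-- because templates commute with homomorphisms.  Hence an equation
-- Γ | Z ⊢ T₁ = T₂ holds in all handled ⟦C⟧ as soon as, for each of the
-- finitely many c ∈ ⟦Γ⟧, it holds in the handled free model over ℕ with
-- distinct generators assigned to the finitely many elements of TVar Z; this
-- instance is decided by the decision procedure of 𝒯.  Conversely, it is the
-- image of an instance in F (1 + ⋯ + 1) with one summand per element of TVar Z.

module Submission where

open import Defs
open import Data.Fin.Base using (Fin; zero; suc; toℕ)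
open import Data.List.Base using (List; []; _∷_; [_]; _++_; map; concatMap; cartesianProduct; cartesianProductWith; allFin; length; lookup)
open import Data.List.Membership.Propositional using (_∈_; lose)
open import Data.List.Membership.Propositional.Properties using (∈-map⁺; ∈-++⁺ˡ; ∈-++⁺ʳ; ∈-concatMap⁺; ∈-cartesianProduct⁺; ∈-cartesianProductWith⁺; ∈-allFin)
open import Data.List.Relation.Unary.All as All using ([]; _∷_)
open import Data.List.Relation.Unary.All.Properties using (lookup-map)
open import Data.List.Relation.Unary.Any using (here; there; index)
open import Data.List.Relation.Unary.Any.Properties using (lookup-index)
open import Data.Nat.Base using (ℕ; zero; suc)
open import Data.Product.Base using (_,_)
open import Data.Unit.Base using (tt)
open import Function.Base using (_∘_)
open import Function.Bundles using (Func)
open import Level using (0ℓ)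
open import Relation.Binary.Bundles using (Setoid)
open import Relation.Binary.PropositionalEquality as ≡ using (_≡_; refl)
open import Relation.Nullary.Decidable.Core using (Dec; map′)
open import Relation.Unary using (Pred; Decidable)

-- `elements` may list an element several times. The codes still separate elements, because `decode`
-- is a left inverse of `encode`.
record Finite (A : Set) : Set where
  field
    elements : List A
    complete : ∀ x → x ∈ elements

  size : ℕ
  size = length elements

  encode : A → Fin size
  encode x = index (complete x)

  decode : Fin size → A
  decode = lookup elements

  decode-encode : ∀ x → decode (encode x) ≡ x
  decode-encode x = ≡.sym (lookup-index (complete x))

  all? : ∀ {P : Pred A 0ℓ} → Decidable P → Dec (∀ x → P x)
  all? P? = map′ (λ ps x → All.lookup ps (complete x)) (λ p → All.tabulate λ {x} _ → p x)
                 (All.all? P? elements)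

open Finite using (elements; complete)

ty-finite : ∀ α → Finite ⟦ α ⟧
ty-finite 𝟙       = record { elements = [ tt ] ; complete = λ _ → here refl }
ty-finite (α ⊗ β) = record
  { elements = cartesianProduct (elements (ty-finite α)) (elements (ty-finite β))
  ; complete = λ (x , y) → ∈-cartesianProduct⁺ (complete (ty-finite α) x) (complete (ty-finite β) y)
  }
ty-finite (⨁ n αs) = record
  { elements = concatMap (λ ℓ → map (ℓ ,_) (elements (ty-finite (αs ℓ)))) (allFin n)
  ; complete = λ (ℓ , x) → ∈-concatMap⁺ _
      (lose (∈-allFin ℓ) (∈-map⁺ (ℓ ,_) (complete (ty-finite (αs ℓ)) x)))
  }

ctx-finite : ∀ Γ → Finite ⟦ Γ ⟧ctx
ctx-finite []      = record { elements = [ [] ] ; complete = λ { [] → here refl } }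
ctx-finite (α ∷ Γ) = record
  { elements = cartesianProductWith _∷_ (elements (ty-finite α)) (elements (ctx-finite Γ))
  ; complete = λ { (a ∷ c) → ∈-cartesianProductWith⁺ _∷_ (complete (ty-finite α) a)
                                                         (complete (ctx-finite Γ) c) }
  }

TVar-finite : ∀ Z → Finite (TVar Z)
TVar-finite []      = record { elements = [] ; complete = λ { (_ , () , _) } }
TVar-finite (β ∷ Z) = record { elements = map first as ++ map weaken vs ; complete = enum }
  where
  as : List ⟦ β ⟧
  as = elements (ty-finite β)
  vs : List (TVar Z)
  vs = elements (TVar-finite Z)
  first : ⟦ β ⟧ → TVar (β ∷ Z)
  first a = β , here refl , a
  weaken : TVar Z → TVar (β ∷ Z)
  weaken (α , z , a) = α , there z , a
  enum : ∀ v → v ∈ map first as ++ map weaken vs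
  enum (_ , here refl , a) = ∈-++⁺ˡ (∈-map⁺ first (complete (ty-finite β) a))
  enum (_ , there z , a)   = ∈-++⁺ʳ (map first as) (∈-map⁺ weaken (complete (TVar-finite Z) (_ , z , a)))

-- The free model over ℕ needs a value for every generator, while an equation constrains only
-- finitely many; `d` fills the rest.
extendℕ : ∀ {A : Set} {n} → A → (Fin n → A) → ℕ → A
extendℕ {n = zero}  d f k       = d
extendℕ {n = suc n} d f zero    = f zero
extendℕ {n = suc n} d f (suc k) = extendℕ d (f ∘ suc) k

extendℕ-toℕ : ∀ {A : Set} {n} (d : A) (f : Fin n → A) i → extendℕ d f (toℕ i) ≡ f i
extendℕ-toℕ d f zero    = refl
extendℕ-toℕ d f (suc i) = extendℕ-toℕ d (f ∘ suc) i

module _ {S : Signature} (M : Structure S) where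

  env : ∀ {Z} → (TVar Z → Structure.Carrier M) → TEnv M Z
  env g = All.tabulate λ z a → g (_ , z , a)

  lookup-env : ∀ {Z} (g : TVar Z → Structure.Carrier M) {α} (z : α ∈ Z) a →
               All.lookup (env g) z a ≡ g (α , z , a)
  lookup-env g (here refl) a = refl
  lookup-env g (there z)   a = lookup-env (λ (α , z , a) → g (α , there z , a)) z a

  SatisfiesAt : (e : Equation S) → ⟦ Equation.Γ e ⟧ctx → TEnv M (Equation.Z e) → Set
  SatisfiesAt e c b = Structure._≈_ M (⟦ Equation.lhs e ⟧⟨ M ⟩ c b) (⟦ Equation.rhs e ⟧⟨ M ⟩ c b)

module _ {S : Signature} {M N : Structure S} {h : Structure.Carrier M → Structure.Carrier N}
         (hom : IsHom M N h) where
  private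
    module N  = Structure N
    module NS = Setoid N.setoid

  -- Environments consist of functions, so `b′` is compared with the image of `b` pointwise rather
  -- than by equality.
  hom-tmpl-≈ : ∀ {Γ Z} (T : Template S Γ Z) c (b : TEnv M Z) (b′ : TEnv N Z) →
               (∀ {α} (z : α ∈ Z) a → h (All.lookup b z a) N.≈ All.lookup b′ z a) →
               h (⟦ T ⟧⟨ M ⟩ c b) N.≈ ⟦ T ⟧⟨ N ⟩ c b′
  hom-tmpl-≈ T c b b′ eq = NS.trans (hom-tmpl hom T c b) (tmpl-cong N T c λ z a →
    NS.trans (NS.reflexive (≡.cong (λ f → f a) (lookup-map {f = h ∘_} b z))) (eq z a))

  hom-SatisfiesAt : ∀ e c (b : TEnv M (Equation.Z e)) (b′ : TEnv N (Equation.Z e)) →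
                    (∀ {α} (z : α ∈ Equation.Z e) a → h (All.lookup b z a) N.≈ All.lookup b′ z a) →
                    SatisfiesAt M e c b → SatisfiesAt N e c b′
  hom-SatisfiesAt e c b b′ eq sat =
    NS.trans (NS.sym (hom-tmpl-≈ (Equation.lhs e) c b b′ eq))
      (NS.trans (IsHom.cong hom sat) (hom-tmpl-≈ (Equation.rhs e) c b b′ eq))

  -- Each handled operation is the denotation of a template, and `hom-tmpl` moves `h` inside, onto
  -- the continuation `κ`.
  handled-hom : (H : HandlerFamily S) → IsHom (handled H M) (handled H N) h
  handled-hom H = record
    { cong = IsHom.cong hom
    ; pres = λ o a κ → hom-tmpl hom (H o) (a ∷ []) (κ ∷ [])
    }

module _ {S : Signature} (𝒯 : Theory S) (H : HandlerFamily S) where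

  Freeℕ : Model 𝒯
  Freeℕ = freeModel 𝒯 (≡.setoid ℕ)

  handledFreeℕ : Structure S
  handledFreeℕ = handled H (Model.structure Freeℕ)

  genericEnv : ∀ Z → TEnv handledFreeℕ Z
  genericEnv Z = env handledFreeℕ λ v → var (toℕ (Finite.encode (TVar-finite Z) v))

  GenericallySatisfied : Equation S → Set
  GenericallySatisfied e = ∀ c → SatisfiesAt handledFreeℕ e c (genericEnv (Equation.Z e))

  genericallySatisfied? : DecidableTheory 𝒯 → Decidable GenericallySatisfied
  -- Equality in `handledFreeℕ` is provability over `≡.setoid ℕ`, so `dec` applies to the two
  -- denotations, which are terms.
  genericallySatisfied? dec e = Finite.all? (ctx-finite (Equation.Γ e)) λ c → dec _ _

  -- By freeness some homomorphism from `Freeℕ` to `M` carries the generic environment to `b`; it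
  -- transports the instance at `c`.
  generic⇒satisfies : ∀ (M : Model 𝒯) {e} → GenericallySatisfied e →
                      Satisfies (handled H (Model.structure M)) e
  generic⇒satisfies M {e} gen c b =
    hom-SatisfiesAt (handled-hom (extend-hom 𝒯 (≡.setoid ℕ) M f) H) e c
      (genericEnv (Equation.Z e)) b eq (gen c)
    where
    module M  = Model M
    module MS = Setoid M.setoid
    open Finite (TVar-finite (Equation.Z e))
    g : TVar (Equation.Z e) → M.Carrier
    g (_ , z , a) = All.lookup b z a
    -- The value of lhs serves as default; M need not be inhabited otherwise.
    f₀ : ℕ → M.Carrier
    f₀ = extendℕ (⟦ Equation.lhs e ⟧⟨ handled H M.structure ⟩ c b) (g ∘ decode)
    f : Func (≡.setoid ℕ) M.setoid
    f = record { to = f₀ ; cong = λ { refl → MS.refl } }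
    eq : ∀ {α} (z : α ∈ Equation.Z e) a →
         extend 𝒯 (≡.setoid ℕ) M f (All.lookup (genericEnv (Equation.Z e)) z a) M.≈ All.lookup b z a
    -- Codes lie below `size`, so the default is never reached here and decoding recovers the
    -- template variable.
    eq z a = MS.reflexive (≡.trans
      (≡.cong (extend 𝒯 (≡.setoid ℕ) M f) (lookup-env handledFreeℕ _ z a))
      (≡.trans (extendℕ-toℕ _ (g ∘ decode) (encode (_ , z , a)))
               (≡.cong g (decode-encode (_ , z , a)))))

  -- ℕ need not be the denotation of a value type, so correctness is applied at a finite sum `A` and
  -- the result is moved to `Freeℕ` by renaming generators.
  correct⇒generic : Correct 𝒯 H → ∀ {e} → e ∈ 𝒯 → GenericallySatisfied e
  correct⇒generic correct {e} e∈𝒯 c =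
    hom-SatisfiesAt (handled-hom (extend-hom 𝒯 X Freeℕ f) H) e c
      b (genericEnv (Equation.Z e)) eq (correct (F A) e∈𝒯 c b)
    where
    open Finite (TVar-finite (Equation.Z e))
    A : VTy
    A = ⨁ size λ _ → 𝟙
    X : Setoid 0ℓ 0ℓ
    X = ⟦_⟧v 𝒯 A
    f : Func X (Model.setoid Freeℕ)
    f = record { to = λ (i , _) → var (toℕ i) ; cong = λ { (inj _ _) → ≈refl } }
    b : TEnv (handled H (freeStructure 𝒯 X)) (Equation.Z e)
    b = env (handled H (freeStructure 𝒯 X)) λ v → var (encode v , tt)
    eq : ∀ {α} (z : α ∈ Equation.Z e) a →
         Provable 𝒯 (≡.setoid ℕ) (extend 𝒯 X Freeℕ f (All.lookup b z a))
                                 (All.lookup (genericEnv (Equation.Z e)) z a)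
    -- Both sides reduce to the generator `var (toℕ (encode (_ , z , a)))`.
    eq z a = Setoid.reflexive (Model.setoid Freeℕ) (≡.trans
      (≡.cong (extend 𝒯 X Freeℕ f) (lookup-env (handled H (freeStructure 𝒯 X)) _ z a))
      (≡.sym (lookup-env handledFreeℕ _ z a)))

theorem6p6 : (S : Signature) (𝒯 : Theory S) → DecidableTheory 𝒯 →
    (H : HandlerFamily S) → Dec (Correct 𝒯 H)
theorem6p6 S 𝒯 dec H = map′
  (λ gen C {e} e∈𝒯 → generic⇒satisfies 𝒯 H (⟦_⟧c 𝒯 C) {e} (All.lookup gen e∈𝒯))
  (λ correct → All.tabulate λ {e} → correct⇒generic 𝒯 H correct {e})
  (All.all? (genericallySatisfied? 𝒯 H dec) 𝒯)
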